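{- For every fixed integer $d\ge 1$, the number of $d$-dimensional permutations of order $n$ satisfies $|S_{d,n}|\ge \exp(\Omega(n^d))$ for even $n$; that is, there is a constant $c>0$ depending only on $d$ such that $|S_{d,n}|\ge \exp(c\,n^d)$ for every even integer $n\ge 2$.
   Context: Write $[n]=\{1,\dots,n\}$. A line of an $[n]^{m}$ array $P$ is a vector of the form $\big(P(i_1,\dots,i_{j-1},t,i_{j+1},\dots,i_m)\big)_{t=1}^n$, where $1\le j\le m$ and the other indices are fixed elements of $[n]$. A $d$-dimensional permutation of order $n$ is an $[n]^{d+1}$ array of zeros and ones in which every line contains exactly one entry equal to $1$. (Equivalently, it is an $[n]^d$ array with entries in $[n]$ in which every line contains each element of $[n]$ exactly once.) $S_{d,n}$ denotes the set of all $d$-dimensional permutations of order $n$. -}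

module Defs where

open import Data.Fin using (Fin)
open import Data.Fin.Patterns using (1F)
open import Data.Fin.Properties using (_≟_; all?; any?)
open import Data.Integer using (+_)
open import Data.List as List using (List; allFin; cartesianProductWith; filter; length)
open import Data.List.Membership.Propositional using (_∈_)
open import Data.List.Membership.Propositional.Properties
  using (∈-allFin; ∈-cartesianProductWith⁺; ∈-filter⁺; ∈-filter⁻)
open import Data.List.Relation.Unary.AllPairs using ([]; _∷_)
open import Data.List.Relation.Unary.All using ([])
open import Data.List.Relation.Unary.Any using (here)
open import Data.List.Relation.Unary.Unique.Propositional using (Unique)
import Data.List.Relation.Unary.Unique.Propositional.Properties as Unique
open import Data.Nat as ℕ using (ℕ; zero; suc; _!)
open import Data.Nat.Properties using (_!≢0)
open import Data.Product using (_,_; ∃-syntax; ∃!; proj₂)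
open import Data.Rational using (ℚ; 0ℚ; _+_; _*_; _/_; _<_; _≤_; +-*-rawSemiring)
open import Data.Vec using (Vec; []; _∷_; lookup; _[_]≔_)
open import Data.Vec.Properties using (∷-injective)
open import Function using (_⇔_; mk⇔)
open import Relation.Binary.PropositionalEquality using (_≡_; refl)
open import Relation.Nullary.Decidable using (Dec; map′; _×-dec_; _→-dec_)
open import Relation.Unary using (Decidable)
open import Algebra.Definitions.RawSemiring +-*-rawSemiring using (_^_)

-- Arrays are nested vectors rather than functions, so that two arrays
-- with the same entries are propositionally equal.

Array : Set → ℕ → ℕ → Set
Array A n zero    = A
Array A n (suc m) = Vec (Array A n m) n

entry : ∀ {A n m} → Array A n m → Vec (Fin n) m → A
entry P []       = P
entry P (i ∷ is) = entry (lookup P i) is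

-- The t-th entry of the line through position i in direction j
-- (the j-th coordinate of i is overwritten, hence irrelevant).

line : ∀ {A n m} → Array A n m → Vec (Fin n) m → Fin m → Fin n → A
line P i j t = entry P (i [ j ]≔ t)

IsPermutation : ∀ d n → Array (Fin 2) n (suc d) → Set
IsPermutation d n P =
  (i : Vec (Fin n) (suc d)) (j : Fin (suc d)) →
  ∃! _≡_ (λ t → line P i j t ≡ 1F)

-- Counting.  |S d n| is the length of a duplicate-free list of all
-- d-dimensional permutations of order n; see ∈-permutations and
-- permutations-unique.

allVec? : ∀ {n} m {P : Vec (Fin n) m → Set} → Decidable P → Dec (∀ v → P v)
allVec? zero    P? = map′ (λ { p [] → p }) (λ p → p []) (P? [])
allVec? (suc m) P? =
  map′ (λ { p (i ∷ is) → p i is }) (λ p i is → p (i ∷ is))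
       (all? λ i → allVec? m λ is → P? (i ∷ is))

∃!? : ∀ {n} {P : Fin n → Set} → Decidable P → Dec (∃! _≡_ P)
∃!? P? = any? λ t → P? t ×-dec
  map′ (λ f {u} → f u) (λ f u → f {u}) (all? λ u → P? u →-dec (t ≟ u))

isPermutation? : ∀ d n → Decidable (IsPermutation d n)
isPermutation? d n P =
  allVec? (suc d) λ i → all? λ j → ∃!? λ t → line P i j t ≟ 1F

allVecs : ∀ {A : Set} → List A → ∀ n → List (Vec A n)
allVecs xs zero    = List.[ [] ]
allVecs xs (suc n) = cartesianProductWith _∷_ xs (allVecs xs n)

allArrays : ∀ {A : Set} → List A → ∀ n m → List (Array A n m)
allArrays xs n zero    = xs
allArrays xs n (suc m) = allVecs (allArrays xs n m) n

permutations : ∀ d n → List (Array (Fin 2) n (suc d))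
permutations d n = filter (isPermutation? d n) (allArrays (allFin 2) n (suc d))

|S| : ℕ → ℕ → ℕ
|S| d n = length (permutations d n)

∈-allVecs : ∀ {A : Set} {xs : List A} → (∀ x → x ∈ xs) →
            ∀ n (v : Vec A n) → v ∈ allVecs xs n
∈-allVecs h zero    []      = here refl
∈-allVecs h (suc n) (x ∷ v) = ∈-cartesianProductWith⁺ _∷_ (h x) (∈-allVecs h n v)

∈-allArrays : ∀ {A : Set} {xs : List A} → (∀ x → x ∈ xs) →
              ∀ n m (P : Array A n m) → P ∈ allArrays xs n m
∈-allArrays h n zero    = h
∈-allArrays h n (suc m) = ∈-allVecs (∈-allArrays h n m) n

allVecs-unique : ∀ {A : Set} {xs : List A} → Unique xs → ∀ n → Unique (allVecs xs n)
allVecs-unique u zero    = [] ∷ []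
allVecs-unique u (suc n) =
  Unique.cartesianProductWith⁺ _∷_ ∷-injective u (allVecs-unique u n)

allArrays-unique : ∀ {A : Set} {xs : List A} → Unique xs →
                   ∀ n m → Unique (allArrays xs n m)
allArrays-unique u n zero    = u
allArrays-unique u n (suc m) = allVecs-unique (allArrays-unique u n m) n

∈-permutations : ∀ d n (P : Array (Fin 2) n (suc d)) →
                 P ∈ permutations d n ⇔ IsPermutation d n P
∈-permutations d n P = mk⇔
  (λ P∈ → proj₂ (∈-filter⁻ (isPermutation? d n) {xs = allArrays (allFin 2) n (suc d)} P∈))
  (∈-filter⁺ (isPermutation? d n) (∈-allArrays ∈-allFin n (suc d) P))

permutations-unique : ∀ d n → Unique (permutations d n)
permutations-unique d n =
  Unique.filter⁺ (isPermutation? d n) (allArrays-unique (Unique.allFin⁺ 2) n (suc d))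

fromℕ : ℕ → ℚ
fromℕ n = + n / 1

-- expSum x k = Σ_{i<k} xⁱ / i!

expSum : ℚ → ℕ → ℚ
expSum x zero    = 0ℚ
expSum x (suc k) = expSum x k + (x ^ k) * (_/_ (+ 1) (k !) {{k !≢0}})

-- exp x ≤ y for rational x and y, where the real number exp x is the
-- limit of the partial sums of its power series: a limit is at most y
-- iff, for each ε > 0, the sequence is eventually at most y + ε.

infix 4 exp_≤_

exp_≤_ : ℚ → ℚ → Set
exp x ≤ y = ∀ ε → 0ℚ < ε → ∃[ K ] (∀ k → K ℕ.≤ k → expSum x k ≤ (y + ε))

{-# OPTIONS --safe #-}
module Submission where

-- Write n = 2k and identify Fin n with Fin k × Fin 2.  For every binary
-- array s of side k and dimension d, let the entry at ((a₀,b₀),…,(a_d,b_d))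
-- be 1 iff Σ aᵢ ≡ 0 mod k and Σ bᵢ ≡ s(a₁,…,a_d) mod 2.  Along a line the
-- first condition fixes the free aⱼ, after which the second fixes bⱼ; and s
-- can be read off the result, so there are at least 2^(k^d) permutations.
-- With c = 2^-(d+1) it remains to see exp(m/2) ≤ 2^m for m = k^d, which
-- follows from exp(x + ½) ≤ exp(x) + ½ exp(x + ½).

open import Defs
open import Data.Fin using (Fin; zero; suc; toℕ; combine; quotient; remainder)
open import Data.Fin.Patterns using (0F; 1F)
open import Data.Fin.Properties
  using (_≟_; toℕ<n; toℕ-injective; toℕ-fromℕ<; combine-surjective; remQuot-combine;
         injective⇒≤)
import Data.Integer as ℤ
import Data.Integer.Solver as ℤ
open import Data.List as List using (List; []; _∷_; allFin; cartesianProductWith; length)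
open import Data.List.Membership.Propositional using (_∈_)
open import Data.List.Membership.Propositional.Properties using (∈-lookup)
import Data.List.Membership.Setoid.Properties as Membership
open import Data.List.Properties using (length-++; length-map)
import Data.List.Relation.Unary.All as All
open import Data.List.Relation.Unary.AllPairs using ([]; _∷_)
open import Data.List.Relation.Unary.Any using (index)
open import Data.List.Relation.Unary.Unique.Propositional using (Unique)
import Data.List.Relation.Unary.Unique.Propositional.Properties as Unique
open import Data.Nat as ℕ using (ℕ; zero; suc; _≤_; _^_; _!)
open import Data.Nat.DivMod
  using (_mod_; _%_; m%n<n; m<n⇒m%n≡m; m%n%n≡m%n; [m+n]%n≡m%n; %-distribˡ-+)
open import Data.Nat.Divisibility using (_∣_; divides)
import Data.Nat.Properties as ℕ
open import Data.Product using (_×_; _,_; proj₁; proj₂; ∃-syntax; ∃!)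
open import Data.Rational as ℚ
  using (ℚ; 0ℚ; 1ℚ; ½; _<_; _*_; NonNegative; Positive; _+_; _-_; -_; _/_; toℚᵘ)
import Data.Rational.Properties as ℚ
open import Data.Rational.Solver using (module +-*-Solver)
open import Data.Rational.Unnormalised as ℚᵘ using (mkℚᵘ; *≡*)
import Data.Rational.Unnormalised.Properties as ℚᵘ
open import Data.Vec
  using (Vec; []; _∷_; lookup; _[_]≔_; map; foldr′; replicate; tabulate; tail; zipWith)
open import Data.Vec.Properties using (lookup∘tabulate; map-[]≔; tabulate∘lookup; tabulate-cong)
open import Function using (_∘_; Injective; Equivalence; _⇔_; mk⇔)
open import Relation.Binary.PropositionalEquality
  using (_≡_; refl; sym; trans; cong; cong₂; subst; subst₂; setoid; module ≡-Reasoning)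
open import Relation.Nullary using (contradiction)
open import Relation.Nullary.Decidable using (Dec; yes; no; _×-dec_)
open import Algebra.Definitions.RawSemiring ℚ.+-*-rawSemiring using () renaming (_^_ to _^ℚ_)

-- Arrays

tabulateArray : ∀ {A : Set} {n} m → (Vec (Fin n) m → A) → Array A n m
tabulateArray zero    f = f []
tabulateArray (suc m) f = tabulate λ i → tabulateArray m (f ∘ (i ∷_))

entry-tabulateArray : ∀ {A : Set} {n} m (f : Vec (Fin n) m → A) i →
                      entry (tabulateArray m f) i ≡ f i
entry-tabulateArray zero    f []      = refl
entry-tabulateArray (suc m) f (i ∷ is) = trans
  (cong (λ P → entry P is) (lookup∘tabulate (λ i → tabulateArray m (f ∘ (i ∷_))) i))
  (entry-tabulateArray m (f ∘ (i ∷_)) is)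

-- Nested vectors are determined by their entries up to propositional equality. This turns the
-- pointwise recovery of `s` from its permutation into injectivity of `permutation`.
entry-injective : ∀ {A : Set} {n} m {P Q : Array A n m} →
                  (∀ i → entry {A} {n} {m} P i ≡ entry {A} {n} {m} Q i) → P ≡ Q
entry-injective zero            eq = eq []
entry-injective (suc m) {P} {Q} eq = begin
  P                    ≡⟨ tabulate∘lookup P ⟨
  tabulate (lookup P)  ≡⟨ tabulate-cong (λ i → entry-injective m (eq ∘ (i ∷_))) ⟩
  tabulate (lookup Q)  ≡⟨ tabulate∘lookup Q ⟩
  Q                    ∎
  where open ≡-Reasoning

-- Counting

lookup-injective : ∀ {A : Set} {xs : List A} → Unique xs →
                   Injective _≡_ _≡_ (List.lookup xs)
lookup-injective (_   ∷ _) {zero}  {zero}  _  = refl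
lookup-injective {xs = _ ∷ xs} (x∉ ∷ _) {zero} {suc j} eq =
  contradiction eq (All.lookup x∉ (∈-lookup {xs = xs} j))
lookup-injective {xs = _ ∷ xs} (x∉ ∷ _) {suc i} {zero} eq =
  contradiction (sym eq) (All.lookup x∉ (∈-lookup {xs = xs} i))
lookup-injective (_   ∷ u) {suc i} {suc j} eq = cong suc (lookup-injective u eq)

-- Positions in `xs` inject into positions in `ys`: the position of a membership proof recovers the
-- element `f x`, and since `xs` is duplicate-free, `x` recovers its own position.
injection⇒length≤ : ∀ {A B : Set} {xs : List A} {ys : List B} (f : A → B) →
                    Injective _≡_ _≡_ f → Unique xs → (∀ x → f x ∈ ys) →
                    length xs ≤ length ys
injection⇒length≤ {xs = xs} f f-inj u f∈ = injective⇒≤ {f = λ i → index (f∈ (List.lookup xs i))}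
  λ eq → lookup-injective u (f-inj (Membership.index-injective (setoid _) (f∈ _) (f∈ _) eq))

length-cartesianProductWith : ∀ {A B C : Set} (f : A → B → C) xs ys →
  length (cartesianProductWith f xs ys) ≡ length xs ℕ.* length ys
length-cartesianProductWith f []       ys = refl
length-cartesianProductWith f (x ∷ xs) ys = trans (length-++ (List.map (f x) ys))
  (cong₂ ℕ._+_ (length-map (f x) ys) (length-cartesianProductWith f xs ys))

length-allVecs : ∀ {A : Set} (xs : List A) n → length (allVecs xs n) ≡ length xs ^ n
length-allVecs xs zero    = refl
length-allVecs xs (suc n) = trans (length-cartesianProductWith _∷_ xs (allVecs xs n))
  (cong (length xs ℕ.*_) (length-allVecs xs n))

length-allArrays : ∀ {A : Set} (xs : List A) n m →
                   length (allArrays xs n m) ≡ length xs ^ (n ^ m)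
length-allArrays xs n zero    = sym (ℕ.*-identityʳ (length xs))
length-allArrays xs n (suc m) = begin
  length (allVecs (allArrays xs n m) n)  ≡⟨ length-allVecs (allArrays xs n m) n ⟩
  length (allArrays xs n m) ^ n          ≡⟨ cong (_^ n) (length-allArrays xs n m) ⟩
  (length xs ^ (n ^ m)) ^ n              ≡⟨ ℕ.^-*-assoc (length xs) (n ^ m) n ⟩
  length xs ^ (n ^ m ℕ.* n)              ≡⟨ cong (length xs ^_) (ℕ.*-comm (n ^ m) n) ⟩
  length xs ^ (n ^ suc m)                ∎
  where open ≡-Reasoning

-- Addition modulo n

[m%d+n]%d≡[m+n]%d : ∀ m n d .{{_ : ℕ.NonZero d}} → (m % d ℕ.+ n) % d ≡ (m ℕ.+ n) % d
[m%d+n]%d≡[m+n]%d m n d = begin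
  (m % d ℕ.+ n) % d              ≡⟨ %-distribˡ-+ (m % d) n d ⟩
  (m % d % d ℕ.+ n % d) % d      ≡⟨ cong (λ r → (r ℕ.+ n % d) % d) (m%n%n≡m%n m d) ⟩
  (m % d ℕ.+ n % d) % d          ≡⟨ %-distribˡ-+ m n d ⟨
  (m ℕ.+ n) % d                  ∎
  where open ≡-Reasoning

module _ {n : ℕ} .{{_ : ℕ.NonZero n}} where

  toℕ-mod : ∀ m → toℕ (m mod n) ≡ m % n
  toℕ-mod m = toℕ-fromℕ< (m%n<n m n)

  infixl 6 _⊕_ _⊖_

  -- Subtraction adds the complement `n ∸ toℕ y`, where truncation never occurs because `toℕ y` is
  -- below `n`.
  _⊕_ _⊖_ : Fin n → Fin n → Fin n
  x ⊕ y = (toℕ x ℕ.+ toℕ y) mod n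
  x ⊖ y = (toℕ x ℕ.+ (n ℕ.∸ toℕ y)) mod n

  ⊕-comm : ∀ x y → x ⊕ y ≡ y ⊕ x
  ⊕-comm x y = cong (_mod n) (ℕ.+-comm (toℕ x) (toℕ y))

  -- Common core of both cancellation laws: `a` and `b` are `toℕ y` and its complement `n ∸ toℕ y`,
  -- in either order.
  mod-cancel : ∀ (x : Fin n) {a b} → a ℕ.+ b ≡ n → ((toℕ x ℕ.+ a) % n ℕ.+ b) mod n ≡ x
  mod-cancel x {a} {b} a+b≡n = toℕ-injective (begin
    toℕ (((toℕ x ℕ.+ a) % n ℕ.+ b) mod n)  ≡⟨ toℕ-mod _ ⟩
    ((toℕ x ℕ.+ a) % n ℕ.+ b) % n          ≡⟨ [m%d+n]%d≡[m+n]%d (toℕ x ℕ.+ a) b n ⟩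
    (toℕ x ℕ.+ a ℕ.+ b) % n                ≡⟨ cong (_% n) (ℕ.+-assoc (toℕ x) a b) ⟩
    (toℕ x ℕ.+ (a ℕ.+ b)) % n              ≡⟨ cong (λ c → (toℕ x ℕ.+ c) % n) a+b≡n ⟩
    (toℕ x ℕ.+ n) % n                      ≡⟨ [m+n]%n≡m%n (toℕ x) n ⟩
    toℕ x % n                              ≡⟨ m<n⇒m%n≡m (toℕ<n x) ⟩
    toℕ x                                  ∎)
    where open ≡-Reasoning

  x⊖y⊕y≡x : ∀ x y → x ⊖ y ⊕ y ≡ x
  x⊖y⊕y≡x x y = trans
    (cong (λ r → (r ℕ.+ toℕ y) mod n) (toℕ-mod _))
    (mod-cancel x (ℕ.m∸n+n≡m (ℕ.<⇒≤ (toℕ<n y))))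

  x⊕y⊖y≡x : ∀ x y → x ⊕ y ⊖ y ≡ x
  x⊕y⊖y≡x x y = trans
    (cong (λ r → (r ℕ.+ (n ℕ.∸ toℕ y)) mod n) (toℕ-mod _))
    (mod-cancel x (ℕ.m+[n∸m]≡n (ℕ.<⇒≤ (toℕ<n y))))

  ⊕-cancelʳ : ∀ {x x′} y → x ⊕ y ≡ x′ ⊕ y → x ≡ x′
  ⊕-cancelʳ {x} {x′} y eq = trans (sym (x⊕y⊖y≡x x y)) (trans (cong (_⊖ y) eq) (x⊕y⊖y≡x x′ y))

  total : ∀ {m} → Vec (Fin n) m → Fin n
  total = foldr′ _⊕_ (0 mod n)

  -- With all other coordinates fixed, `total` is a translation of the cyclic group in the
  -- coordinate `j`. The induction moves each earlier coordinate to the other side of the equation,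
  -- changing the target from `c` to `c ⊖ x`.
  total-bijective : ∀ {m} (v : Vec (Fin n) m) j c → ∃! _≡_ λ t → total (v [ j ]≔ t) ≡ c
  total-bijective (x ∷ v) zero c = c ⊖ total v , x⊖y⊕y≡x c (total v) ,
    λ eq → ⊕-cancelʳ (total v) (trans (x⊖y⊕y≡x c (total v)) (sym eq))
  total-bijective (x ∷ v) (suc j) c with total-bijective v j (c ⊖ x)
  ... | t , eq , t-unique = t ,
    trans (⊕-comm x _) (trans (cong (_⊕ x) eq) (x⊖y⊕y≡x c x)) ,
    λ eq′ → t-unique (⊕-cancelʳ x (trans (⊕-comm _ x) (trans eq′ (sym (x⊖y⊕y≡x c x)))))

-- The permutations attached to binary arrays of half the order

indicator : {P : Set} → Dec P → Fin 2
indicator (yes _) = 1F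
indicator (no  _) = 0F

indicator⁺ : {P : Set} (P? : Dec P) → P → indicator P? ≡ 1F
indicator⁺ (yes _) _ = refl
indicator⁺ (no ¬p) p = contradiction p ¬p

indicator⁻ : {P : Set} (P? : Dec P) → indicator P? ≡ 1F → P
indicator⁻ (yes p) _ = p

map-quotient-combine : ∀ {k l m} (a : Vec (Fin k) m) (b : Vec (Fin l) m) →
                       map (quotient l) (zipWith combine a b) ≡ a
map-quotient-combine []      []      = refl
map-quotient-combine (x ∷ a) (y ∷ b) =
  cong₂ _∷_ (cong proj₁ (remQuot-combine x y)) (map-quotient-combine a b)

map-remainder-combine : ∀ {k l m} (a : Vec (Fin k) m) (b : Vec (Fin l) m) →
                        map (remainder {k} l) (zipWith combine a b) ≡ b
map-remainder-combine []      []      = refl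
map-remainder-combine (x ∷ a) (y ∷ b) =
  cong₂ _∷_ (cong proj₂ (remQuot-combine x y)) (map-remainder-combine a b)

module _ {k d : ℕ} .{{_ : ℕ.NonZero k}} where

  quotients : ∀ {m} → Vec (Fin (k ℕ.* 2)) m → Vec (Fin k) m
  quotients = map (quotient 2)

  remainders : ∀ {m} → Vec (Fin (k ℕ.* 2)) m → Vec (Fin 2) m
  remainders = map (remainder {k} 2)

  -- On the set `total a ≡ 0 mod k` the tail determines the head, so an array `s` indexed by
  -- `tail a` is an arbitrary binary labelling of that set.
  OnSupport : Array (Fin 2) k d → Vec (Fin k) (suc d) → Vec (Fin 2) (suc d) → Set
  OnSupport s a b = total a ≡ 0 mod k × total b ≡ entry s (tail a)

  onSupport? : ∀ s a b → Dec (OnSupport s a b)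
  onSupport? s a b = (total a ≟ 0 mod k) ×-dec (total b ≟ entry s (tail a))

  permutation : Array (Fin 2) k d → Array (Fin 2) (k ℕ.* 2) (suc d)
  permutation s = tabulateArray (suc d) λ i → indicator (onSupport? s (quotients i) (remainders i))

  entry-permutation : ∀ s i →
    entry (permutation s) i ≡ indicator (onSupport? s (quotients i) (remainders i))
  entry-permutation s = entry-tabulateArray (suc d) _

  entry-permutation⁺ : ∀ s i → OnSupport s (quotients i) (remainders i) →
                       entry (permutation s) i ≡ 1F
  entry-permutation⁺ s i p = trans (entry-permutation s i)
    (indicator⁺ (onSupport? s (quotients i) (remainders i)) p)

  entry-permutation⁻ : ∀ s i → entry (permutation s) i ≡ 1F →
                       OnSupport s (quotients i) (remainders i)
  entry-permutation⁻ s i eq = indicator⁻ (onSupport? s (quotients i) (remainders i))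
    (trans (sym (entry-permutation s i)) eq)

  -- Overwriting a coordinate commutes with taking quotients and remainders. A line of the large
  -- array thus becomes a pair of lines, one of side `k` and one of side 2, with separate unknowns
  -- `t` and `u`.
  line-permutation : ∀ s i j t u →
    let a = quotients i [ j ]≔ t
        b = remainders i [ j ]≔ u
    in line (permutation s) i j (combine t u) ≡ 1F ⇔ OnSupport s a b
  line-permutation s i j t u = mk⇔
    (subst₂ (OnSupport s) quotients≡ remainders≡ ∘ entry-permutation⁻ s i′)
    (entry-permutation⁺ s i′ ∘ subst₂ (OnSupport s) (sym quotients≡) (sym remainders≡))
    where
    i′ = i [ j ]≔ combine t u

    quotients≡ : quotients i′ ≡ quotients i [ j ]≔ t
    quotients≡ = trans (map-[]≔ (quotient 2) i j)
      (cong ((quotients i [ j ]≔_) ∘ proj₁) (remQuot-combine t u))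

    remainders≡ : remainders i′ ≡ remainders i [ j ]≔ u
    remainders≡ = trans (map-[]≔ (remainder {k} 2) i j)
      (cong ((remainders i [ j ]≔_) ∘ proj₂) (remQuot-combine t u))

  permutation-isPermutation : ∀ s → IsPermutation d (k ℕ.* 2) (permutation s)
  permutation-isPermutation s i j
    with t , t-sol , t-unique ← total-bijective (quotients i) j (0 mod k)
    -- The parity target is read from `s` after `t` is in place, since overwriting coordinate `j`
    -- may change the tail.
    with u , u-sol , u-unique ←
           total-bijective (remainders i) j (entry s (tail (quotients i [ j ]≔ t)))
    = combine t u , Equivalence.from (line-permutation s i j t u) (t-sol , u-sol) , unique
    where
    unique : ∀ {y} → line (permutation s) i j y ≡ 1F → combine t u ≡ y
    unique {y} eq
      with t′ , u′ , refl ← combine-surjective {k} {2} y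
      with t′-sol , u′-sol ← Equivalence.to (line-permutation s i j t′ u′) eq
      -- Identifying `t′` with `t` gives both parity equations the same right-hand side, so that
      -- `u-unique` applies.
      with refl ← t-unique t′-sol
      = cong (combine t) (u-unique u′-sol)

  -- Every `a` extends to a position where `permutation s` has a 1 and whose binary coordinates sum
  -- to `entry s a`. Since `permutation s′` has a 1 there too, the same sum equals `entry s′ a`.
  permutation-injective : Injective _≡_ _≡_ permutation
  permutation-injective {s} {s′} eq = entry-injective d agree
    where
    agree : ∀ a → entry s a ≡ entry s′ a
    agree a
      -- The heads `0 mod k` and, on the next line, `0F` are placeholders that `t` and `u`
      -- overwrite; the other binary coordinates stay 0.
      with t , t-sol , _ ← total-bijective (0 mod k ∷ a) zero (0 mod k)
      with u , u-sol , _ ← total-bijective (replicate (suc d) 0F) zero (entry s a)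
      = trans (sym u-sol) (proj₂ onSupport′)
      where
      b = u ∷ replicate d 0F
      i = zipWith combine (t ∷ a) b

      onSupport : OnSupport s (quotients i) (remainders i)
      onSupport = subst₂ (OnSupport s) (sym (map-quotient-combine (t ∷ a) b))
        (sym (map-remainder-combine (t ∷ a) b)) (t-sol , u-sol)

      onSupport′ : OnSupport s′ (t ∷ a) b
      onSupport′ = subst₂ (OnSupport s′) (map-quotient-combine (t ∷ a) b)
        (map-remainder-combine (t ∷ a) b)
        (entry-permutation⁻ s′ i
          (trans (cong (λ P → entry P i) (sym eq)) (entry-permutation⁺ s i onSupport)))

2^[k^d]≤|S| : ∀ d k .{{_ : ℕ.NonZero k}} → 2 ^ (k ^ d) ≤ |S| d (k ℕ.* 2)
2^[k^d]≤|S| d k = subst (_≤ |S| d (k ℕ.* 2)) (length-allArrays (allFin 2) k d)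
  (injection⇒length≤ permutation permutation-injective
    (allArrays-unique (Unique.allFin⁺ 2) k d)
    λ s → Equivalence.from (∈-permutations d (k ℕ.* 2) (permutation s))
            (permutation-isPermutation s))

-- The exponential bound

-- `_/_` reduces to lowest terms by a gcd that does not compute on variables. In the unnormalised
-- rationals only an integer identity between cross products remains.
fromℕ-homo-+ : ∀ m n → fromℕ (m ℕ.+ n) ≡ fromℕ m + fromℕ n
fromℕ-homo-+ m n = ℚ.toℚᵘ-injective (begin
  toℚᵘ (fromℕ (m ℕ.+ n))                ≈⟨ ℚ.toℚᵘ-fromℚᵘ (mkℚᵘ (ℤ.+ (m ℕ.+ n)) 0) ⟩
  mkℚᵘ (ℤ.+ (m ℕ.+ n)) 0                  ≈⟨ *≡* numerators ⟩
  mkℚᵘ (ℤ.+ m) 0 ℚᵘ.+ mkℚᵘ (ℤ.+ n) 0        ≈⟨ ℚᵘ.+-cong (ℚ.toℚᵘ-fromℚᵘ (mkℚᵘ (ℤ.+ m) 0))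
                                                      (ℚ.toℚᵘ-fromℚᵘ (mkℚᵘ (ℤ.+ n) 0)) ⟨
  toℚᵘ (fromℕ m) ℚᵘ.+ toℚᵘ (fromℕ n)    ≈⟨ ℚ.toℚᵘ-homo-+ (fromℕ m) (fromℕ n) ⟨
  toℚᵘ (fromℕ m + fromℕ n)              ∎)
  where
  open ℚᵘ.≃-Reasoning
  open ℤ.+-*-Solver
  numerators : (ℤ.+ m ℤ.+ ℤ.+ n) ℤ.* ℤ.1ℤ ≡ (ℤ.+ m ℤ.* ℤ.1ℤ ℤ.+ ℤ.+ n ℤ.* ℤ.1ℤ) ℤ.* ℤ.1ℤ
  numerators = solve 2
    (λ m n → (m :+ n) :* con ℤ.1ℤ := (m :* con ℤ.1ℤ :+ n :* con ℤ.1ℤ) :* con ℤ.1ℤ)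
    refl (ℤ.+ m) (ℤ.+ n)

fromℕ-homo-* : ∀ m n → fromℕ (m ℕ.* n) ≡ fromℕ m * fromℕ n
fromℕ-homo-* zero    n = sym (ℚ.*-zeroˡ (fromℕ n))
fromℕ-homo-* (suc m) n = begin
  fromℕ (n ℕ.+ m ℕ.* n)          ≡⟨ fromℕ-homo-+ n (m ℕ.* n) ⟩
  fromℕ n + fromℕ (m ℕ.* n)      ≡⟨ cong (fromℕ n +_) (fromℕ-homo-* m n) ⟩
  fromℕ n + fromℕ m * fromℕ n    ≡⟨ solve 2 (λ m n → n :+ m :* n := (con 1ℚ :+ m) :* n) refl
                                      (fromℕ m) (fromℕ n) ⟩
  (1ℚ + fromℕ m) * fromℕ n       ≡⟨ cong (_* fromℕ n) (fromℕ-homo-+ 1 m) ⟨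
  fromℕ (suc m) * fromℕ n        ∎
  where open ≡-Reasoning; open +-*-Solver

fromℕ-nonNeg : ∀ n → NonNegative (fromℕ n)
fromℕ-nonNeg n = ℚ.normalize-nonNeg n 1

fromℕ-mono-≤ : ∀ {m n} → m ≤ n → fromℕ m ℚ.≤ fromℕ n
fromℕ-mono-≤ {m} {n} m≤n = begin
  fromℕ m                       ≡⟨ ℚ.+-identityʳ (fromℕ m) ⟨
  fromℕ m + 0ℚ                  ≤⟨ ℚ.+-monoʳ-≤ (fromℕ m) (ℚ.nonNegative⁻¹ _ {{fromℕ-nonNeg (n ℕ.∸ m)}}) ⟩
  fromℕ m + fromℕ (n ℕ.∸ m)     ≡⟨ fromℕ-homo-+ m (n ℕ.∸ m) ⟨
  fromℕ (m ℕ.+ (n ℕ.∸ m))       ≡⟨ cong fromℕ (ℕ.m+[n∸m]≡n m≤n) ⟩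
  fromℕ n                       ∎
  where open ℚ.≤-Reasoning

1/[m*n]*m≡1/n : ∀ m n .{{_ : ℕ.NonZero n}} .{{_ : ℕ.NonZero (suc m ℕ.* n)}} →
                ℤ.+ 1 / (suc m ℕ.* n) * fromℕ (suc m) ≡ ℤ.+ 1 / n
1/[m*n]*m≡1/n m n@(suc q) = ℚ.toℚᵘ-injective (begin
  toℚᵘ (ℤ.+ 1 / (suc m ℕ.* n) * fromℕ (suc m))
    ≈⟨ ℚ.toℚᵘ-homo-* (ℤ.+ 1 / (suc m ℕ.* n)) (fromℕ (suc m)) ⟩
  toℚᵘ (ℤ.+ 1 / (suc m ℕ.* n)) ℚᵘ.* toℚᵘ (fromℕ (suc m))
    -- `mkℚᵘ` takes the denominator minus one; as `n` is `suc q`, the predecessor of `suc m * n` is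
    -- `q + m * n`.
    ≈⟨ ℚᵘ.*-cong (ℚ.toℚᵘ-fromℚᵘ (mkℚᵘ (ℤ.+ 1) (q ℕ.+ m ℕ.* n)))
                 (ℚ.toℚᵘ-fromℚᵘ (mkℚᵘ (ℤ.+ suc m) 0)) ⟩
  mkℚᵘ (ℤ.+ 1) (q ℕ.+ m ℕ.* n) ℚᵘ.* mkℚᵘ (ℤ.+ suc m) 0
    ≈⟨ *≡* (cong ℤ.+_ numerators) ⟩
  mkℚᵘ (ℤ.+ 1) q
    ≈⟨ ℚ.toℚᵘ-fromℚᵘ (mkℚᵘ (ℤ.+ 1) q) ⟨
  toℚᵘ (ℤ.+ 1 / n)
    ∎)
  where
  open ℚᵘ.≃-Reasoning
  numerators : 1 ℕ.* suc m ℕ.* n ≡ 1 ℕ.* (suc m ℕ.* n ℕ.* 1)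
  numerators = trans (cong (ℕ._* n) (ℕ.*-identityˡ (suc m)))
    (sym (trans (ℕ.*-identityˡ _) (ℕ.*-identityʳ _)))

1/_! : ℕ → ℚ
1/ k ! = _/_ (ℤ.+ 1) (k !) {{k ℕ.!≢0}}

1/!-nonNeg : ∀ k → NonNegative (1/ k !)
1/!-nonNeg k = ℚ.normalize-nonNeg 1 (k !) {{k ℕ.!≢0}}

1/!-suc : ∀ k → 1/ suc k ! * fromℕ (suc k) ≡ 1/ k !
1/!-suc k = 1/[m*n]*m≡1/n k (k !) {{k ℕ.!≢0}} {{suc k ℕ.!≢0}}

^-nonNeg : ∀ x .{{_ : NonNegative x}} k → NonNegative (x ^ℚ k)
^-nonNeg x zero    = _
^-nonNeg x (suc k) = ℚ.nonNeg*nonNeg⇒nonNeg x (x ^ℚ k) {{^-nonNeg x k}}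

p≤p+nonNeg : ∀ p q .{{_ : NonNegative q}} → p ℚ.≤ p + q
p≤p+nonNeg p q = subst (ℚ._≤ p + q) (ℚ.+-identityʳ p) (ℚ.+-monoʳ-≤ p (ℚ.nonNegative⁻¹ q))

^-mono-≤ : ∀ {x y} .{{_ : NonNegative x}} .{{_ : NonNegative y}} k →
           x ℚ.≤ y → x ^ℚ k ℚ.≤ y ^ℚ k
^-mono-≤         zero    x≤y = ℚ.≤-refl
^-mono-≤ {x} {y} (suc k) x≤y = begin
  x * x ^ℚ k  ≤⟨ ℚ.*-monoʳ-≤-nonNeg (x ^ℚ k) {{^-nonNeg x k}} x≤y ⟩
  y * x ^ℚ k  ≤⟨ ℚ.*-monoˡ-≤-nonNeg y (^-mono-≤ k x≤y) ⟩
  y * y ^ℚ k  ∎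
  where open ℚ.≤-Reasoning

-- Growth of the partial sums of the exponential series.

module _ (x a : ℚ) {{_ : NonNegative x}} {{_ : NonNegative a}} where

  private
    z : ℚ
    z = x + a

    instance
      z-nonNeg : NonNegative z
      z-nonNeg = ℚ.nonNeg+nonNeg⇒nonNeg x a

  -- Convexity: a chord of t ↦ t^(1+k) has slope at most the derivative at its right end z.
  [x+a]^[1+k]≤ : ∀ k → z ^ℚ suc k ℚ.≤ x ^ℚ suc k + fromℕ (suc k) * (a * z ^ℚ k)
  [x+a]^[1+k]≤ zero    = ℚ.≤-reflexive
    (solve 2 (λ x a → (x :+ a) :* con 1ℚ := x :* con 1ℚ :+ con 1ℚ :* (a :* con 1ℚ)) refl x a)
    where open +-*-Solver
  [x+a]^[1+k]≤ (suc k) = begin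
    z * z ^ℚ suc k
      ≤⟨ ℚ.*-monoˡ-≤-nonNeg z ([x+a]^[1+k]≤ k) ⟩
    z * (x ^ℚ suc k + c * (a * z ^ℚ k))
      ≡⟨ solve 5 (λ x a p c q → (x :+ a) :* (p :+ c :* (a :* q)) :=
                                x :* p :+ (a :* p :+ c :* (a :* ((x :+ a) :* q)))) refl
           x a (x ^ℚ suc k) c (z ^ℚ k) ⟩
    x * x ^ℚ suc k + (a * x ^ℚ suc k + c * (a * z ^ℚ suc k))
      -- Bounding `x` by `z` in `a * x ^ℚ suc k` yields one more copy of `a * z ^ℚ suc k`, which
      -- raises the coefficient `c` by one.
      ≤⟨ ℚ.+-monoʳ-≤ (x * x ^ℚ suc k) (ℚ.+-monoˡ-≤ (c * (a * z ^ℚ suc k))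
           (ℚ.*-monoˡ-≤-nonNeg a (^-mono-≤ (suc k) (p≤p+nonNeg x a)))) ⟩
    x * x ^ℚ suc k + (a * z ^ℚ suc k + c * (a * z ^ℚ suc k))
      ≡⟨ cong (x * x ^ℚ suc k +_)
           (solve 2 (λ p c → p :+ c :* p := (con 1ℚ :+ c) :* p) refl (a * z ^ℚ suc k) c) ⟩
    x * x ^ℚ suc k + (1ℚ + c) * (a * z ^ℚ suc k)
      ≡⟨ cong (λ c → x * x ^ℚ suc k + c * (a * z ^ℚ suc k)) (fromℕ-homo-+ 1 (suc k)) ⟨
    x * x ^ℚ suc k + fromℕ (suc (suc k)) * (a * z ^ℚ suc k)
      ∎
    where
    open ℚ.≤-Reasoning
    open +-*-Solver
    c = fromℕ (suc k)

  -- Termwise form of exp z ≤ exp x + a exp z: dividing the power inequality by (k+1)! turns its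
  -- last summand into a z^k / k!. This index shift makes the sum multiplied by `a` one term
  -- shorter.
  expSum-+-≤ : ∀ k → expSum z (suc k) ℚ.≤ expSum x (suc k) + a * expSum z k
  expSum-+-≤ zero    = ℚ.≤-reflexive (sym
    (trans (cong (expSum x 1 +_) (ℚ.*-zeroʳ a)) (ℚ.+-identityʳ _)))
  expSum-+-≤ (suc k) = begin
    expSum z (suc k) + z ^ℚ suc k * r
      ≤⟨ ℚ.+-mono-≤ (expSum-+-≤ k)
           (ℚ.*-monoʳ-≤-nonNeg r {{1/!-nonNeg (suc k)}} ([x+a]^[1+k]≤ k)) ⟩
    (e + a * f) + (x ^ℚ suc k + c * (a * z ^ℚ k)) * r
      ≡⟨ solve 7 (λ e a f p c q r → (e :+ a :* f) :+ (p :+ c :* (a :* q)) :* r :=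
                                    (e :+ p :* r) :+ a :* (f :+ q :* (r :* c))) refl
           e a f (x ^ℚ suc k) c (z ^ℚ k) r ⟩
    (e + x ^ℚ suc k * r) + a * (f + z ^ℚ k * (r * c))
      ≡⟨ cong (λ q → (e + x ^ℚ suc k * r) + a * (f + z ^ℚ k * q)) (1/!-suc k) ⟩
    expSum x (suc (suc k)) + a * expSum z (suc k)
      ∎
    where
    open ℚ.≤-Reasoning
    open +-*-Solver
    r = 1/ suc k !
    c = fromℕ (suc k)
    e = expSum x (suc k)
    f = expSum z k

expSum-suc-≤ : ∀ x .{{_ : NonNegative x}} k → expSum x k ℚ.≤ expSum x (suc k)
expSum-suc-≤ x k = p≤p+nonNeg _ _
  {{ℚ.nonNeg*nonNeg⇒nonNeg (x ^ℚ k) {{^-nonNeg x k}} (1/ k !) {{1/!-nonNeg k}}}}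

p≤q+½p⇒p≤q+q : ∀ p q → p ℚ.≤ q + ½ * p → p ℚ.≤ q + q
p≤q+½p⇒p≤q+q p q p≤ = begin
  p                          ≡⟨ solve 1 (λ p → p := (p :- con ½ :* p) :+ (p :- con ½ :* p)) refl p ⟩
  (p - h) + (p - h)          ≤⟨ ℚ.+-mono-≤ h≤q h≤q ⟩
  q + q                      ∎
  where
  open ℚ.≤-Reasoning
  open +-*-Solver
  h = ½ * p
  h≤q : p - h ℚ.≤ q
  h≤q = begin
    p - h        ≤⟨ ℚ.+-monoˡ-≤ (- h) p≤ ⟩
    (q + h) - h  ≡⟨ solve 2 (λ q h → (q :+ h) :- h := q) refl q h ⟩
    q            ∎

-- Lengthening the shorter sum by a nonnegative term puts the same quantity on both sides. For the
-- increment ½, moving half of it to the left leaves a factor of exactly 2.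
expSum-+½-≤ : ∀ x {{_ : NonNegative x}} k →
              expSum (x + ½) (suc k) ℚ.≤ expSum x (suc k) + expSum x (suc k)
expSum-+½-≤ x k = p≤q+½p⇒p≤q+q _ (expSum x (suc k)) (ℚ.≤-trans (expSum-+-≤ x ½ k)
  (ℚ.+-monoʳ-≤ (expSum x (suc k)) (ℚ.*-monoˡ-≤-nonNeg ½
    (expSum-suc-≤ (x + ½) {{ℚ.nonNeg+nonNeg⇒nonNeg x ½}} k))))

-- Only the term 0^0 / 0! survives, so the sum must have at least one term.
expSum-0 : ∀ k → expSum 0ℚ (suc k) ≡ 1ℚ
expSum-0 zero    = refl
expSum-0 (suc k) = begin
  expSum 0ℚ (suc k) + 0ℚ * 0ℚ ^ℚ k * 1/ suc k !
    ≡⟨ cong (λ x → expSum 0ℚ (suc k) + x * 1/ suc k !) (ℚ.*-zeroˡ (0ℚ ^ℚ k)) ⟩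
  expSum 0ℚ (suc k) + 0ℚ * 1/ suc k !
    ≡⟨ cong₂ _+_ (expSum-0 k) (ℚ.*-zeroˡ (1/ suc k !)) ⟩
  1ℚ
    ∎
  where open ≡-Reasoning

-- Raising `m` by one adds ½ to the exponent and doubles the bound. The bound holds for each
-- nonempty partial sum, not merely in the limit.
expSum-½m≤2^m : ∀ m k → expSum (fromℕ m * ½) (suc k) ℚ.≤ fromℕ (2 ^ m)
expSum-½m≤2^m zero    k = ℚ.≤-reflexive (expSum-0 k)
expSum-½m≤2^m (suc m) k = begin
  expSum (fromℕ (suc m) * ½) (suc k)
    ≡⟨ cong (λ x → expSum x (suc k)) [1+m]/2 ⟩
  expSum (fromℕ m * ½ + ½) (suc k)
    ≤⟨ expSum-+½-≤ (fromℕ m * ½) {{m/2-nonNeg}} k ⟩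
  e + e
    ≤⟨ ℚ.+-mono-≤ (expSum-½m≤2^m m k) (expSum-½m≤2^m m k) ⟩
  fromℕ (2 ^ m) + fromℕ (2 ^ m)
    ≡⟨ fromℕ-homo-+ (2 ^ m) (2 ^ m) ⟨
  fromℕ (2 ^ m ℕ.+ 2 ^ m)
    ≡⟨ cong (λ n → fromℕ (2 ^ m ℕ.+ n)) (ℕ.+-identityʳ (2 ^ m)) ⟨
  fromℕ (2 ^ suc m)
    ∎
  where
  open ℚ.≤-Reasoning
  e = expSum (fromℕ m * ½) (suc k)
  m/2-nonNeg = ℚ.nonNeg*nonNeg⇒nonNeg (fromℕ m) {{fromℕ-nonNeg m}} ½
  [1+m]/2 : fromℕ (suc m) * ½ ≡ fromℕ m * ½ + ½
  [1+m]/2 = trans (cong (_* ½) (fromℕ-homo-+ 1 m))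
    (solve 1 (λ m → (con 1ℚ :+ m) :* con ½ := m :* con ½ :+ con ½) refl (fromℕ m))
    where open +-*-Solver

-- The constant and the final bound.

½^-pos : ∀ d → Positive (½ ^ℚ d)
½^-pos zero    = _
½^-pos (suc d) = ℚ.pos*pos⇒pos ½ (½ ^ℚ d) {{½^-pos d}}

½^d*[k*2]^d≡k^d : ∀ k d → ½ ^ℚ d * fromℕ ((k ℕ.* 2) ^ d) ≡ fromℕ (k ^ d)
½^d*[k*2]^d≡k^d k zero    = refl
½^d*[k*2]^d≡k^d k (suc d) = begin
  ½ * ½ ^ℚ d * fromℕ (k ℕ.* 2 ℕ.* n^d)
    ≡⟨ cong (½ * ½ ^ℚ d *_) (trans (fromℕ-homo-* (k ℕ.* 2) n^d)
         (cong (_* fromℕ n^d) (fromℕ-homo-* k 2))) ⟩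
  ½ * ½ ^ℚ d * (fromℕ k * fromℕ 2 * fromℕ n^d)
    ≡⟨ solve 3 (λ h k n → con ½ :* h :* (k :* con (fromℕ 2) :* n) := k :* (h :* n)) refl
         (½ ^ℚ d) (fromℕ k) (fromℕ n^d) ⟩
  fromℕ k * (½ ^ℚ d * fromℕ n^d)
    ≡⟨ cong (fromℕ k *_) (½^d*[k*2]^d≡k^d k d) ⟩
  fromℕ k * fromℕ (k ^ d)
    ≡⟨ fromℕ-homo-* k (k ^ d) ⟨
  fromℕ (k ^ suc d)
    ∎
  where
  open ≡-Reasoning
  open +-*-Solver
  n^d = (k ℕ.* 2) ^ d

-- Of the d+1 factors ½, d pass from the order to half the order, and the last is the ½ in exp(m/2)
-- ≤ 2^m.
½^[1+d]*[k*2]^d≡½k^d : ∀ k d → ½ ^ℚ suc d * fromℕ ((k ℕ.* 2) ^ d) ≡ fromℕ (k ^ d) * ½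
½^[1+d]*[k*2]^d≡½k^d k d = trans (ℚ.*-assoc ½ (½ ^ℚ d) (fromℕ ((k ℕ.* 2) ^ d)))
  (trans (cong (½ *_) (½^d*[k*2]^d≡k^d k d)) (ℚ.*-comm ½ (fromℕ (k ^ d))))

exp≤|S| : ∀ d k .{{_ : ℕ.NonZero k}} →
          exp (½ ^ℚ suc d * fromℕ ((k ℕ.* 2) ^ d)) ≤ fromℕ (|S| d (k ℕ.* 2))
-- The threshold 1 works for every `ε`: it excludes only the empty sum, so each remaining length has
-- the form `suc l`.
exp≤|S| d k ε ε>0 = 1 , bound
  where
  open ℚ.≤-Reasoning
  n = k ℕ.* 2

  bound : ∀ l → 1 ≤ l → expSum (½ ^ℚ suc d * fromℕ (n ^ d)) l ℚ.≤ fromℕ (|S| d n) + ε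
  bound (suc l) _ = begin
    expSum (½ ^ℚ suc d * fromℕ (n ^ d)) (suc l)
      ≡⟨ cong (λ x → expSum x (suc l)) (½^[1+d]*[k*2]^d≡½k^d k d) ⟩
    expSum (fromℕ (k ^ d) * ½) (suc l)
      ≤⟨ expSum-½m≤2^m (k ^ d) l ⟩
    fromℕ (2 ^ (k ^ d))
      ≤⟨ fromℕ-mono-≤ (2^[k^d]≤|S| d k) ⟩
    fromℕ (|S| d n)
      ≤⟨ p≤p+nonNeg (fromℕ (|S| d n)) ε {{ℚ.nonNegative (ℚ.<⇒≤ ε>0)}} ⟩
    fromℕ (|S| d n) + ε
      ∎

mainTheorem3 : (d : ℕ) → 1 ≤ d →
    ∃[ c ] (0ℚ < c × ((n : ℕ) → 2 ≤ n → 2 ∣ n → exp (c * fromℕ (n ^ d)) ≤ fromℕ (|S| d n)))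
mainTheorem3 d _ = ½ ^ℚ suc d , ℚ.positive⁻¹ (½ ^ℚ suc d) {{½^-pos (suc d)}} , bound
  where
  bound : ∀ n → 2 ≤ n → 2 ∣ n → exp (½ ^ℚ suc d * fromℕ (n ^ d)) ≤ fromℕ (|S| d n)
  -- The bound 2 ≤ n rules out the quotient zero, which makes half the order nonzero as addition
  -- modulo `k` requires.
  bound _ _  (divides (suc k) refl) = exp≤|S| d (suc k)
  bound _ () (divides zero    refl)
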